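{- Let $k\ge 2$, let $U$ be a finite nonempty set, let $f:\{0,\ldots,k\}^U\to\mathbb{R}_{+}$ be a $k$-submodular function attaining its maximum value on an orthant $\mathbf{o}\in\{1,\ldots,k\}^U$, and let $\mathbf{x}$ be an orthant selected uniformly at random from $\{1,\ldots,k\}^U$. Then $\mathbb{E}[f(\mathbf{x})]\ge\frac14 f(\mathbf{o})$ if $k=2$, and $\mathbb{E}[f(\mathbf{x})]\ge\frac1k f(\mathbf{o})$ if $k\ge 3$.
   Context: $\mathbb{R}_{+}$ denotes the non-negative reals. For $s,t\in\{0,\ldots,k\}$ define $\mathrm{min}_0(s,t)=0$ if $s\neq 0$, $t\neq 0$ and $s\neq t$, and $\mathrm{min}_0(s,t)=\min(s,t)$ otherwise; define $\mathrm{max}_0(s,t)=0$ if $s\neq 0$, $t\neq 0$ and $s\neq t$, and $\mathrm{max}_0(s,t)=\max(s,t)$ otherwise. Both operations are applied coordinate-wise to vectors. $f$ is $k$-submodular if $f(\mathbf{s})+f(\mathbf{t})\ge f(\mathrm{min}_0(\mathbf{s},\mathbf{t}))+f(\mathrm{max}_0(\mathbf{s},\mathbf{t}))$ for all $\mathbf{s},\mathbf{t}\in\{0,\ldots,k\}^U$. An orthant is a vector in $\{1,\ldots,k\}^U$ (no zero coordinate). -}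

module Defs where

import Algebra.Construct.NaturalChoice.Max as Max
import Algebra.Construct.NaturalChoice.Min as Min
open import Data.Bool.Base using (if_then_else_)
open import Data.Empty using (⊥-elim)
open import Data.Fin.Base using (Fin; zero; suc)
import Data.Fin.Properties as Fin
open import Data.Integer.Base using (+_)
open import Data.List.Base
  using (List; []; _∷_; map; foldr; length; allFin; cartesianProductWith)
import Data.List.Properties as List
open import Data.List.Membership.Propositional using (_∈_)
open import Data.List.Membership.Propositional.Properties
  using (∈-map⁺; ∈-map⁻; ∈-allFin; ∈-cartesianProductWith⁺; ∈-cartesianProductWith⁻)
open import Data.List.Relation.Unary.Any using (here)
import Data.List.Relation.Unary.All as ListAll
import Data.List.Relation.Unary.AllPairs as AllPairs
open import Data.List.Relation.Unary.Unique.Propositional using (Unique)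
import Data.List.Relation.Unary.Unique.Propositional.Properties as Unique
open import Data.Nat.Base as ℕ using (ℕ; NonZero)
import Data.Nat.Properties as ℕ
open import Data.Product.Base using (∃-syntax; _×_; _,_)
open import Data.Rational.Base as ℚ
  using (ℚ; 0ℚ; 1ℚ; ½; ∣_∣; 1/_; _/_; Positive)
import Data.Rational.Properties as ℚ
open import Data.Rational.Solver using (module +-*-Solver)
open import Data.Vec.Base using (Vec; []; _∷_; zipWith)
open import Data.Vec.Properties using (∷-injective)
open import Data.Vec.Relation.Unary.All using (All; []; _∷_)
open import Relation.Binary.PropositionalEquality
open import Relation.Nullary using (Dec; does; ¬?; _×-dec_)

-- Real numbers, as Cauchy sequences of rationals. Two sequences denote the
-- same real when each is ≤ᵣ the other.

record ℝ : Set where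
  constructor mkℝ
  field
    seq    : ℕ → ℚ
    cauchy : ∀ ε → 0ℚ ℚ.< ε →
             ∃[ N ] (∀ m n → N ℕ.≤ m → N ℕ.≤ n → ∣ seq m ℚ.- seq n ∣ ℚ.< ε)

open ℝ public

infix  4 _≤ᵣ_
infixl 6 _+ᵣ_
infixr 7 _·ᵣ_

_≤ᵣ_ : ℝ → ℝ → Set
x ≤ᵣ y = ∀ ε → 0ℚ ℚ.< ε → ∃[ N ] (∀ n → N ℕ.≤ n → seq x n ℚ.≤ seq y n ℚ.+ ε)

0ᵣ : ℝ
0ᵣ = mkℝ (λ _ → 0ℚ) (λ _ 0<ε → 0 , λ _ _ _ _ → 0<ε)

_+ᵣ_ : ℝ → ℝ → ℝ
x +ᵣ y = mkℝ (λ n → seq x n ℚ.+ seq y n) +-cauchy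
  where
  interchange : ∀ a b c d → (a ℚ.+ b) ℚ.- (c ℚ.+ d) ≡ (a ℚ.- c) ℚ.+ (b ℚ.- d)
  interchange = solve 4 (λ a b c d →
    (a :+ b) :- (c :+ d) := (a :- c) :+ (b :- d)) refl
    where open +-*-Solver

  ½+½ : ∀ p → ½ ℚ.* p ℚ.+ ½ ℚ.* p ≡ p
  ½+½ p = trans (sym (ℚ.*-distribʳ-+ p ½ ½)) (ℚ.*-identityˡ p)

  +-cauchy : ∀ ε → 0ℚ ℚ.< ε → ∃[ N ] (∀ m n → N ℕ.≤ m → N ℕ.≤ n →
             ∣ (seq x m ℚ.+ seq y m) ℚ.- (seq x n ℚ.+ seq y n) ∣ ℚ.< ε)
  +-cauchy ε 0<ε =
    let δ   = ½ ℚ.* ε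
        0<δ = subst (ℚ._< δ) (ℚ.*-zeroʳ ½) (ℚ.*-monoʳ-<-pos ½ 0<ε)
        M , x-close = cauchy x δ 0<δ
        N , y-close = cauchy y δ 0<δ
    in M ℕ.⊔ N , λ m n le le′ → begin-strict
      ∣ (seq x m ℚ.+ seq y m) ℚ.- (seq x n ℚ.+ seq y n) ∣
        ≡⟨ cong ∣_∣ (interchange (seq x m) (seq y m) (seq x n) (seq y n)) ⟩
      ∣ (seq x m ℚ.- seq x n) ℚ.+ (seq y m ℚ.- seq y n) ∣
        ≤⟨ ℚ.∣p+q∣≤∣p∣+∣q∣ (seq x m ℚ.- seq x n) (seq y m ℚ.- seq y n) ⟩
      ∣ seq x m ℚ.- seq x n ∣ ℚ.+ ∣ seq y m ℚ.- seq y n ∣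
        <⟨ ℚ.+-mono-< (x-close m n (ℕ.m⊔n≤o⇒m≤o M N le) (ℕ.m⊔n≤o⇒m≤o M N le′))
                      (y-close m n (ℕ.m⊔n≤o⇒n≤o M N le) (ℕ.m⊔n≤o⇒n≤o M N le′)) ⟩
      δ ℚ.+ δ
        ≡⟨ ½+½ ε ⟩
      ε ∎
    where open ℚ.≤-Reasoning

_·ᵣ_ : ℚ → ℝ → ℝ
q ·ᵣ x = mkℝ (λ n → q ℚ.* seq x n) ·-cauchy
  where
  factor : ∀ a b → q ℚ.* a ℚ.- q ℚ.* b ≡ q ℚ.* (a ℚ.- b)
  factor = solve 3 (λ q a b → q :* a :- q :* b := q :* (a :- b)) refl q
    where open +-*-Solver

  c : ℚ
  c = 1ℚ ℚ.+ ∣ q ∣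

  instance
    c-pos : Positive c
    c-pos = ℚ.pos+nonNeg⇒pos 1ℚ ∣ q ∣ {{ℚ.∣-∣-nonNeg q}}

    c-nonZero : ℚ.NonZero c
    c-nonZero = ℚ.pos⇒nonZero c

  ∣q∣≤c : ∣ q ∣ ℚ.≤ c
  ∣q∣≤c = subst (ℚ._≤ c) (ℚ.+-identityˡ ∣ q ∣)
            (ℚ.+-monoˡ-≤ ∣ q ∣ (ℚ.nonNegative⁻¹ 1ℚ))

  ·-cauchy : ∀ ε → 0ℚ ℚ.< ε → ∃[ N ] (∀ m n → N ℕ.≤ m → N ℕ.≤ n →
             ∣ q ℚ.* seq x m ℚ.- q ℚ.* seq x n ∣ ℚ.< ε)
  ·-cauchy ε 0<ε =
    let δ   = 1/ c ℚ.* ε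
        0<δ = subst (ℚ._< δ) (ℚ.*-zeroʳ (1/ c))
                (ℚ.*-monoʳ-<-pos (1/ c) {{ℚ.1/pos⇒pos c}} 0<ε)
        N , x-close = cauchy x δ 0<δ
    in N , λ m n le le′ →
      let d = seq x m ℚ.- seq x n in begin-strict
      ∣ q ℚ.* seq x m ℚ.- q ℚ.* seq x n ∣
        ≡⟨ cong ∣_∣ (factor (seq x m) (seq x n)) ⟩
      ∣ q ℚ.* d ∣
        ≡⟨ ℚ.∣p*q∣≡∣p∣*∣q∣ q d ⟩
      ∣ q ∣ ℚ.* ∣ d ∣
        ≤⟨ ℚ.*-monoʳ-≤-nonNeg ∣ d ∣ {{ℚ.∣-∣-nonNeg d}} ∣q∣≤c ⟩
      c ℚ.* ∣ d ∣
        <⟨ ℚ.*-monoʳ-<-pos c (x-close m n le le′) ⟩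
      c ℚ.* (1/ c ℚ.* ε)
        ≡⟨ ℚ.*-assoc c (1/ c) ε ⟨
      c ℚ.* 1/ c ℚ.* ε
        ≡⟨ cong (ℚ._* ε) (ℚ.*-inverseʳ c) ⟩
      1ℚ ℚ.* ε
        ≡⟨ ℚ.*-identityˡ ε ⟩
      ε ∎
    where open ℚ.≤-Reasoning

-- The ground set is U = Fin n, and {0,…,k}^U is the type
-- Vec (Fin (suc k)) n.

module _ {k : ℕ} where

  open Min (Fin.≤-totalOrder (ℕ.suc k)) using (_⊓_)
  open Max (Fin.≤-totalOrder (ℕ.suc k)) using (_⊔_)

  conflict? : (s t : Fin (ℕ.suc k)) → Dec (s ≢ zero × t ≢ zero × s ≢ t)
  conflict? s t = ¬? (s Fin.≟ zero) ×-dec ¬? (t Fin.≟ zero) ×-dec ¬? (s Fin.≟ t)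

  min₀ max₀ : Fin (ℕ.suc k) → Fin (ℕ.suc k) → Fin (ℕ.suc k)
  min₀ s t = if does (conflict? s t) then zero else s ⊓ t
  max₀ s t = if does (conflict? s t) then zero else s ⊔ t

module _ {k n : ℕ} where

  k-Submodular : (Vec (Fin (ℕ.suc k)) n → ℝ) → Set
  k-Submodular f = ∀ s t →
    f (zipWith min₀ s t) +ᵣ f (zipWith max₀ s t) ≤ᵣ f s +ᵣ f t

  Orthant : Vec (Fin (ℕ.suc k)) n → Set
  Orthant = All (_≢ zero)

orthants : ∀ k n → List (Vec (Fin (ℕ.suc k)) n)
orthants k ℕ.zero    = [] ∷ []
orthants k (ℕ.suc n) = cartesianProductWith _∷_ (map suc (allFin k)) (orthants k n)

-- `orthants k n` lists every orthant exactly once, k ^ n of them in total.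

orthant⇒∈ : ∀ {k n} {s : Vec (Fin (ℕ.suc k)) n} → Orthant s → s ∈ orthants k n
orthant⇒∈ []                          = here refl
orthant⇒∈ {s = zero  ∷ _} (s≢0 ∷ _)   = ⊥-elim (s≢0 refl)
orthant⇒∈ {s = suc i ∷ _} (_   ∷ s≢0) =
  ∈-cartesianProductWith⁺ _∷_ (∈-map⁺ suc (∈-allFin i)) (orthant⇒∈ s≢0)

∈⇒orthant : ∀ {k n} {s : Vec (Fin (ℕ.suc k)) n} → s ∈ orthants k n → Orthant s
∈⇒orthant {n = ℕ.zero}  {[]} _ = []
∈⇒orthant {k} {ℕ.suc n} s∈
  with _ , _ , i∈ , t∈ , refl ←
         ∈-cartesianProductWith⁻ _∷_ (map suc (allFin k)) (orthants k n) s∈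
  with _ , _ , refl ← ∈-map⁻ suc i∈
  = (λ ()) ∷ ∈⇒orthant t∈

orthants-unique : ∀ k n → Unique (orthants k n)
orthants-unique k ℕ.zero    = ListAll.[] AllPairs.∷ AllPairs.[]
orthants-unique k (ℕ.suc n) = Unique.cartesianProductWith⁺ _∷_ ∷-injective
  (Unique.map⁺ Fin.suc-injective (Unique.allFin⁺ k)) (orthants-unique k n)

length-cartesianProductWith :
  ∀ {A B C : Set} (f : A → B → C) xs ys →
  length (cartesianProductWith f xs ys) ≡ length xs ℕ.* length ys
length-cartesianProductWith f []       ys = refl
length-cartesianProductWith f (x ∷ xs) ys = trans
  (List.length-++ (map (f x) ys))
  (cong₂ ℕ._+_ (List.length-map (f x) ys) (length-cartesianProductWith f xs ys))

length-orthants : ∀ k n → length (orthants k n) ≡ k ℕ.^ n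
length-orthants k ℕ.zero    = refl
length-orthants k (ℕ.suc n) = trans
  (length-cartesianProductWith _∷_ (map suc (allFin k)) (orthants k n))
  (cong₂ ℕ._*_
    (trans (List.length-map suc (allFin k)) (List.length-tabulate {n = k} (λ i → i)))
    (length-orthants k n))

sumᵣ : List ℝ → ℝ
sumᵣ = foldr _+ᵣ_ 0ᵣ

𝔼-orthant : ∀ {k n} → .{{NonZero k}} → (Vec (Fin (ℕ.suc k)) n → ℝ) → ℝ
𝔼-orthant {k} {n} f =
  (_/_ (+ 1) (k ℕ.^ n) {{ℕ.m^n≢0 k n}}) ·ᵣ sumᵣ (map f (orthants k n))

{-# OPTIONS --safe #-}

-- Both bounds are strengthened so that they can be proved by induction on the
-- coordinates. Write 0 for the zero vector.
--
-- For k ≥ 3: E f(x) ≥ (1/k) f(o) + (1 - 1/k) f(0). In the first coordinate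
-- there are at least two labels i ≠ o₁, and averaging
-- f(i,s) + f(j,s) ≥ 2 f(0,s) over them replaces f(i,s) by f(0,s); the step is
-- then closed by f(o₁,0) + f(0,o) ≥ f(o₁,o) + f(0,0).
--
-- For k = 2: E f(x) ≥ ¼ (f(o) + 2 f(0) + f(o′)), where o′ is the orthant
-- opposite to o. With a = o₁ and b = o₁′, the step adds up
--   f(a,o′) + f(b,0) ≥ f(0,o′) + f(0,0),   f(b,o) + f(a,0) ≥ f(0,o) + f(0,0),
--   f(a,0) + f(0,o) ≥ f(a,o) + f(0,0),     f(b,0) + f(0,o′) ≥ f(b,o′) + f(0,0).

module Submission where

open import Defs
open import Algebra.Bundles using (CommutativeRing)
import Algebra.Construct.NaturalChoice.Max as Max
import Algebra.Construct.NaturalChoice.Min as Min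
open import Data.Fin.Base using (Fin; zero; suc; punchIn)
open import Data.Fin.Properties using (punchIn-injective; suc-injective; ≤-totalOrder)
open import Data.Integer.Base as ℤ using (+_)
import Data.Integer.Properties as ℤ
open import Data.List.Base using ([]; _∷_; map; tabulate; cartesianProductWith; _++_)
import Data.List.Properties as List
open import Data.Nat.Base as ℕ using (ℕ; zero; suc; _≤_; s≤s; NonZero)
import Data.Nat.Properties as ℕ
open import Data.Product.Base using (_×_; _,_; ∃-syntax)
open import Data.Rational.Base as ℚ
  using (ℚ; 0ℚ; 1ℚ; ½; _/_; _+_; _*_; _-_; 1/_; Positive; fromℚᵘ)
import Data.Rational.Properties as ℚ
open import Algebra.Properties.CommutativeMonoid.Sum ℚ.+-0-commutativeMonoid
  using (sum; sum-remove; sum-cong-≗)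
open import Algebra.Properties.Semiring.Sum (CommutativeRing.semiring ℚ.+-*-commutativeRing)
  using (*-distribˡ-sum)
open import Data.Rational.Solver using (module +-*-Solver)
open import Data.Rational.Unnormalised.Base as ℚᵘ using (mkℚᵘ)
import Data.Rational.Unnormalised.Properties as ℚᵘ
open import Data.Vec.Base as Vec using (Vec; []; _∷_; zipWith; replicate)
open import Data.Vec.Properties
  using (zipWith-idem; zipWith-zeroˡ; zipWith-zeroʳ; zipWith-identityˡ; zipWith-identityʳ)
open import Data.Vec.Relation.Unary.All using ([]; _∷_)
open import Function.Base using (_∘_; id)
open import Relation.Binary.PropositionalEquality
open import Relation.Nullary.Decidable using (dec-true; dec-false)
open import Relation.Nullary.Negation using (contradiction)

open +-*-Solver

-- Eventual inequalities between rational sequences.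

infix 4 _≼_

-- x ≤ᵣ y unfolds to the field of seq x ≼ seq y; the record lets x and y be inferred.
record _≼_ (x y : ℕ → ℚ) : Set where
  constructor mk≼
  field eventually : ∀ ε → 0ℚ ℚ.< ε → ∃[ N ] (∀ n → N ℕ.≤ n → x n ℚ.≤ y n + ε)

open _≼_

-- The differences `y′ - x′` and `y - x` agree termwise, so one inequality gives the other.
-- Deductions from linear combinations of inequalities thus reduce to ring identities.
≼-shift : ∀ {x y x′ y′} → x ≼ y → (∀ n → x′ n + y n ≡ y′ n + x n) → x′ ≼ y′
≼-shift {x} {y} {x′} {y′} x≼y eq = mk≼ λ ε 0<ε → let N , h = eventually x≼y ε 0<ε in
  N , λ n N≤n → begin
    x′ n                     ≡⟨ lhs (x′ n) (y n) ⟩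
    (x′ n + y n) - y n       ≡⟨ cong (_- y n) (eq n) ⟩
    (y′ n + x n) - y n       ≤⟨ ℚ.+-monoˡ-≤ (ℚ.- y n) (ℚ.+-monoʳ-≤ (y′ n) (h n N≤n)) ⟩
    (y′ n + (y n + ε)) - y n ≡⟨ rhs (y′ n) (y n) ε ⟩
    y′ n + ε                 ∎
  where
  open ℚ.≤-Reasoning
  lhs : ∀ a b → a ≡ (a + b) - b
  lhs = solve 2 (λ a b → a := (a :+ b) :- b) refl
  rhs : ∀ a b c → (a + (b + c)) - b ≡ a + c
  rhs = solve 3 (λ a b c → (a :+ (b :+ c)) :- b := a :+ c) refl

≼-refl : ∀ {x} → x ≼ x
≼-refl {x} = mk≼ λ ε 0<ε → 0 , λ n _ → subst (ℚ._≤ x n + ε) (ℚ.+-identityʳ (x n))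
  (ℚ.+-monoʳ-≤ (x n) (ℚ.<⇒≤ 0<ε))

scale-pos : ∀ q .{{_ : Positive q}} {ε} → 0ℚ ℚ.< ε → 0ℚ ℚ.< q * ε
scale-pos q {ε} 0<ε = subst (ℚ._< q * ε) (ℚ.*-zeroʳ q) (ℚ.*-monoʳ-<-pos q 0<ε)

≼-+ : ∀ {x y x′ y′} → x ≼ y → x′ ≼ y′ → (λ n → x n + x′ n) ≼ (λ n → y n + y′ n)
≼-+ {x} {y} {x′} {y′} x≼y x′≼y′ = mk≼ λ ε 0<ε →
  let M , h  = eventually x≼y   (½ * ε) (scale-pos ½ 0<ε)
      N , h′ = eventually x′≼y′ (½ * ε) (scale-pos ½ 0<ε)
  in M ℕ.⊔ N , λ n le → ℚ.≤-trans
  (ℚ.+-mono-≤ (h n (ℕ.m⊔n≤o⇒m≤o M N le)) (h′ n (ℕ.m⊔n≤o⇒n≤o M N le)))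
  (ℚ.≤-reflexive (regroup (y n) (y′ n) ε))
  where
  regroup : ∀ a b c → (a + ½ * c) + (b + ½ * c) ≡ (a + b) + c
  regroup = solve 3 (λ a b c → (a :+ con ½ :* c) :+ (b :+ con ½ :* c) := (a :+ b) :+ c) refl

≼-· : ∀ q .{{_ : Positive q}} {x y} → x ≼ y → (λ n → q * x n) ≼ (λ n → q * y n)
≼-· q {x} {y} x≼y = mk≼ λ ε 0<ε →
  let N , h = eventually x≼y (1/q * ε) (scale-pos 1/q {{ℚ.1/pos⇒pos q}} 0<ε)
  in N , λ n N≤n → begin
    q * x n                   ≤⟨ ℚ.*-monoˡ-≤-nonNeg q {{ℚ.pos⇒nonNeg q}} (h n N≤n) ⟩
    q * (y n + 1/q * ε)       ≡⟨ ℚ.*-distribˡ-+ q (y n) (1/q * ε) ⟩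
    q * y n + q * (1/q * ε)   ≡⟨ cong (_+_ (q * y n)) (ℚ.*-assoc q 1/q ε) ⟨
    q * y n + q * 1/q * ε     ≡⟨ cong (λ u → q * y n + u * ε) (ℚ.*-inverseʳ q {{ℚ.pos⇒nonZero q}}) ⟩
    q * y n + 1ℚ * ε          ≡⟨ cong (_+_ (q * y n)) (ℚ.*-identityˡ ε) ⟩
    q * y n + ε               ∎
  where
  open ℚ.≤-Reasoning
  1/q = (1/ q) {{ℚ.pos⇒nonZero q}}

≼-reflexive : ∀ {x y : ℕ → ℚ} → (∀ n → x n ≡ y n) → x ≼ y
≼-reflexive {y = y} eq = ≼-shift ≼-refl λ n → cong (_+ y n) (eq n)

≼-trans : ∀ {x y z} → x ≼ y → y ≼ z → x ≼ z
≼-trans {x} {y} {z} x≼y y≼z = ≼-shift (≼-+ x≼y y≼z) λ n →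
  solve 3 (λ x y z → x :+ (y :+ z) := z :+ (x :+ y)) refl (x n) (y n) (z n)

-- The claim fails for a single term, so the induction, which removes two terms
-- at a time, starts from two and from three.
pairwise⇒sum : ∀ m {a : Fin (2 ℕ.+ m) → ℕ → ℚ} {c : ℕ → ℚ} →
  (∀ i j → i ≢ j → (λ n → c n + c n) ≼ (λ n → a i n + a j n)) →
  (λ n → sum {2 ℕ.+ m} (λ _ → c n)) ≼ (λ n → sum (λ i → a i n))
pairwise⇒sum 0 {a} {c} h = ≼-shift (h zero (suc zero) λ ()) λ n →
  solve 3 (λ a b c → (c :+ (c :+ con 0ℚ)) :+ (a :+ b) := (a :+ (b :+ con 0ℚ)) :+ (c :+ c)) refl
    (a zero n) (a (suc zero) n) (c n)
pairwise⇒sum 1 {a} {c} h =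
  -- Each of the three indices lies in two of the three pairs, hence the factor `½`.
  ≼-shift (≼-· ½ (≼-+ (≼-+ (h zero (suc zero) λ ()) (h zero (suc (suc zero)) λ ()))
                      (h (suc zero) (suc (suc zero)) λ ()))) λ n →
  solve 4 (λ x y z c →
    (c :+ (c :+ (c :+ con 0ℚ))) :+ con ½ :* (((x :+ y) :+ (x :+ z)) :+ (y :+ z))
    := (x :+ (y :+ (z :+ con 0ℚ))) :+ con ½ :* (((c :+ c) :+ (c :+ c)) :+ (c :+ c))) refl
    (a zero n) (a (suc zero) n) (a (suc (suc zero)) n) (c n)
pairwise⇒sum (suc (suc m)) {a} {c} h =
  ≼-shift (≼-+ (h zero (suc zero) λ ())
               (pairwise⇒sum m {λ i → a (suc (suc i))} {c} λ i j i≢j →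
                 h (suc (suc i)) (suc (suc j)) λ { refl → i≢j refl })) λ n →
  solve 5 (λ x y s c t →
    (c :+ (c :+ t)) :+ ((x :+ y) :+ s) := (x :+ (y :+ s)) :+ ((c :+ c) :+ t)) refl
    (a zero n) (a (suc zero) n) (sum (λ i → a (suc (suc i)) n)) (c n)
    (sum {2 ℕ.+ m} (λ _ → c n))

-- Arithmetic of fractions.

-- Operations on `ℚ` cancel common factors and so do not compute on variable fractions; the
-- unnormalised ones do, and identities are transported from there.
fromℚᵘ-homo-+ : ∀ p q → fromℚᵘ p + fromℚᵘ q ≡ fromℚᵘ (p ℚᵘ.+ q)
fromℚᵘ-homo-+ p q = ℚ.toℚᵘ-injective (ℚᵘ.≃-trans (ℚ.toℚᵘ-homo-+ (fromℚᵘ p) (fromℚᵘ q))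
  (ℚᵘ.≃-trans (ℚᵘ.+-cong (ℚ.toℚᵘ-fromℚᵘ p) (ℚ.toℚᵘ-fromℚᵘ q))
    (ℚᵘ.≃-sym (ℚ.toℚᵘ-fromℚᵘ (p ℚᵘ.+ q)))))

fromℚᵘ-homo-* : ∀ p q → fromℚᵘ p * fromℚᵘ q ≡ fromℚᵘ (p ℚᵘ.* q)
fromℚᵘ-homo-* p q = ℚ.toℚᵘ-injective (ℚᵘ.≃-trans (ℚ.toℚᵘ-homo-* (fromℚᵘ p) (fromℚᵘ q))
  (ℚᵘ.≃-trans (ℚᵘ.*-cong (ℚ.toℚᵘ-fromℚᵘ p) (ℚ.toℚᵘ-fromℚᵘ q))
    (ℚᵘ.≃-sym (ℚ.toℚᵘ-fromℚᵘ (p ℚᵘ.* q)))))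

1/-* : ∀ m n .{{_ : NonZero m}} .{{_ : NonZero n}} →
       (+ 1 / m) * (+ 1 / n) ≡ (+ 1 / (m ℕ.* n)) {{ℕ.m*n≢0 m n}}
1/-* (suc m) (suc n) = fromℚᵘ-homo-* (mkℚᵘ (+ 1) m) (mkℚᵘ (+ 1) n)

suc/1 : ∀ m → + suc m / 1 ≡ 1ℚ + + m / 1
suc/1 m = sym (trans (fromℚᵘ-homo-+ (mkℚᵘ (+ 1) 0) (mkℚᵘ (+ m) 0))
  (ℚ./-cong {+ 1 ℤ.* + 1 ℤ.+ + m ℤ.* + 1} (cong (λ u → + 1 ℤ.+ u) (ℤ.*-identityʳ (+ m))) refl))

sum-const : ∀ m x → sum {m} (λ _ → x) ≡ (+ m / 1) * x
sum-const zero    x = sym (ℚ.*-zeroˡ x)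
sum-const (suc m) x = trans (cong (_+_ x) (sum-const m x))
  (trans (distrib x (+ m / 1)) (cong (_* x) (sym (suc/1 m))))
  where
  distrib : ∀ x m → x + m * x ≡ (1ℚ + m) * x
  distrib = solve 2 (λ x m → x :+ m :* x := (con 1ℚ :+ m) :* x) refl

1/k*k : ∀ k .{{_ : NonZero k}} → (+ 1 / k) * (+ k / 1) ≡ 1ℚ
1/k*k (suc k) = trans (fromℚᵘ-homo-* (mkℚᵘ (+ 1) k) (mkℚᵘ (+ suc k) 0))
  (ℚ.fromℚᵘ-cong (ℚᵘ.*-inverseˡ (mkℚᵘ (+ suc k) 0)))

-- The expectation as an iterated average.

-- The uniform average, taken one coordinate at a time so that induction on the coordinates unfolds
-- it. It is rational because it is formed separately at each index of the Cauchy sequences.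
mean : ∀ k .{{_ : NonZero k}} {n} → (Vec (Fin (suc k)) n → ℚ) → ℚ
mean k {zero}  g = g []
mean k {suc n} g = (+ 1 / k) * sum {k} (λ i → mean k (λ s → g (suc i ∷ s)))

seq-sum-++ : ∀ {A : Set} (f : A → ℝ) xs ys m →
  seq (sumᵣ (map f (xs ++ ys))) m ≡ seq (sumᵣ (map f xs)) m + seq (sumᵣ (map f ys)) m
seq-sum-++ f []       ys m = sym (ℚ.+-identityˡ _)
seq-sum-++ f (x ∷ xs) ys m = trans (cong (_+_ (seq (f x) m)) (seq-sum-++ f xs ys m))
  (sym (ℚ.+-assoc (seq (f x) m) _ _))

-- An arbitrary `h` is allowed because the recursion on `k` passes to `h ∘ suc`.
seq-sum-product : ∀ {A B C : Set} {k} (f : C → ℝ) (_·_ : A → B → C) (h : Fin k → A) ys m →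
  seq (sumᵣ (map f (cartesianProductWith _·_ (tabulate h) ys))) m
  ≡ sum (λ i → seq (sumᵣ (map (λ y → f (h i · y)) ys)) m)
seq-sum-product {k = zero}  f _·_ h ys m = refl
seq-sum-product {k = suc k} f _·_ h ys m = trans
  (seq-sum-++ f (map (h zero ·_) ys) _ m)
  (cong₂ _+_ (cong (λ l → seq (sumᵣ l) m) (sym (List.map-∘ ys)))
             (seq-sum-product f _·_ (h ∘ suc) ys m))

-- The weight of an orthant factors as `1 / k` for the first label times `1 / k ^ n` for the tail;
-- the second factor moves inside the sum over first labels.
𝔼-mean : ∀ k .{{_ : NonZero k}} {n} (f : Vec (Fin (suc k)) n → ℝ) m →
         seq (𝔼-orthant f) m ≡ mean k (λ s → seq (f s) m)
𝔼-mean k {zero}  f m = trans (ℚ.*-identityˡ _) (ℚ.+-identityʳ _)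
𝔼-mean k {suc n} f m = begin
  r′ * seq (sumᵣ (map f (orthants k (suc n)))) m
    ≡⟨ cong (λ is → r′ * seq (sumᵣ (map f (cartesianProductWith _∷_ is (orthants k n)))) m)
            (List.map-tabulate id suc) ⟩
  r′ * seq (sumᵣ (map f (cartesianProductWith _∷_ (tabulate suc) (orthants k n)))) m
    ≡⟨ cong (r′ *_) (seq-sum-product f _∷_ suc (orthants k n) m) ⟩
  r′ * sum S
    ≡⟨ cong (_* sum S) (1/-* k (k ℕ.^ n)) ⟨
  (+ 1 / k) * r * sum S
    ≡⟨ ℚ.*-assoc (+ 1 / k) r (sum S) ⟩
  (+ 1 / k) * (r * sum S)
    ≡⟨ cong ((+ 1 / k) *_) (*-distribˡ-sum r S) ⟩
  (+ 1 / k) * sum (λ i → r * S i)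
    ≡⟨ cong ((+ 1 / k) *_) (sum-cong-≗ (λ i → 𝔼-mean k (λ s → f (suc i ∷ s)) m)) ⟩
  (+ 1 / k) * sum (λ i → mean k (λ s → seq (f (suc i ∷ s)) m)) ∎
  where
  open ≡-Reasoning
  instance
    k^n≢0 : NonZero (k ℕ.^ n)
    k^n≢0 = ℕ.m^n≢0 k n
  r r′ : ℚ
  r  = + 1 / k ℕ.^ n
  r′ = (+ 1 / k ℕ.^ suc n) {{ℕ.m^n≢0 k (suc n)}}
  S : Fin k → ℚ
  S i = seq (sumᵣ (map (λ s → f (suc i ∷ s)) (orthants k n))) m

-- Algebra of `min₀` and `max₀`.

module _ {k : ℕ} where

  open Min (≤-totalOrder (suc k)) using (⊓-idem)
  open Max (≤-totalOrder (suc k)) using (⊔-idem)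

  min₀-idem : ∀ (i : Fin (suc k)) → min₀ i i ≡ i
  min₀-idem i rewrite dec-false (conflict? i i) (λ (_ , _ , i≢i) → i≢i refl) = ⊓-idem i

  max₀-idem : ∀ (i : Fin (suc k)) → max₀ i i ≡ i
  max₀-idem i rewrite dec-false (conflict? i i) (λ (_ , _ , i≢i) → i≢i refl) = ⊔-idem i

  min₀-zeroˡ : ∀ (i : Fin (suc k)) → min₀ zero i ≡ zero
  min₀-zeroˡ zero    = refl
  min₀-zeroˡ (suc i) = refl

  min₀-zeroʳ : ∀ (i : Fin (suc k)) → min₀ i zero ≡ zero
  min₀-zeroʳ zero    = refl
  min₀-zeroʳ (suc i) = refl

  max₀-identityˡ : ∀ (i : Fin (suc k)) → max₀ zero i ≡ i
  max₀-identityˡ zero    = refl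
  max₀-identityˡ (suc i) = refl

  max₀-identityʳ : ∀ (i : Fin (suc k)) → max₀ i zero ≡ i
  max₀-identityʳ zero    = refl
  max₀-identityʳ (suc i) = refl

  min₀-conflict : ∀ {i j : Fin (suc k)} → i ≢ zero → j ≢ zero → i ≢ j → min₀ i j ≡ zero
  min₀-conflict {i} {j} i≢0 j≢0 i≢j
    rewrite dec-true (conflict? i j) (i≢0 , j≢0 , i≢j) = refl

  max₀-conflict : ∀ {i j : Fin (suc k)} → i ≢ zero → j ≢ zero → i ≢ j → max₀ i j ≡ zero
  max₀-conflict {i} {j} i≢0 j≢0 i≢j
    rewrite dec-true (conflict? i j) (i≢0 , j≢0 , i≢j) = refl

-- Instances of k-submodularity.

submodular : ∀ {k n} (f : Vec (Fin (suc k)) n → ℝ) → k-Submodular f → ∀ s t {p q} →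
  zipWith min₀ s t ≡ p → zipWith max₀ s t ≡ q →
  (λ m → seq (f p) m + seq (f q) m) ≼ (λ m → seq (f s) m + seq (f t) m)
submodular f sub s t refl refl = mk≼ (sub s t)

-- Both operations are idempotent, so a common first label is preserved.
slice-submodular : ∀ {k n} (f : Vec (Fin (suc k)) (suc n) → ℝ) → k-Submodular f →
                   ∀ i → k-Submodular (λ s → f (i ∷ s))
slice-submodular f sub i s t =
  subst₂ (λ p q → f (p ∷ zipWith min₀ s t) +ᵣ f (q ∷ zipWith max₀ s t) ≤ᵣ f (i ∷ s) +ᵣ f (i ∷ t))
    (min₀-idem i) (max₀-idem i) (sub (i ∷ s) (i ∷ t))

private
  variable k n : ℕ

𝟎 : Vec (Fin (suc k)) n
𝟎 = replicate _ zero

module _ (f : Vec (Fin (suc k)) (suc n) → ℝ) (sub : k-Submodular f)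
         {i j : Fin (suc k)} (i≢0 : i ≢ zero) (j≢0 : j ≢ zero) (i≢j : i ≢ j) where

  private
    F : Fin (suc k) → Vec (Fin (suc k)) n → ℕ → ℚ
    F i s = seq (f (i ∷ s))

  -- Both operations send the conflicting labels to `zero`, and idempotence keeps the common tail.
  conflict-≼ : ∀ s → (λ m → F zero s m + F zero s m) ≼ (λ m → F i s m + F j s m)
  conflict-≼ s = submodular f sub (i ∷ s) (j ∷ s)
    (cong₂ _∷_ (min₀-conflict i≢0 j≢0 i≢j) (zipWith-idem min₀-idem s))
    (cong₂ _∷_ (max₀-conflict i≢0 j≢0 i≢j) (zipWith-idem max₀-idem s))

  -- The first labels again cancel to `zero`; on the tails `s` and `𝟎`, `min₀` gives `𝟎` and `max₀`
  -- gives `s`.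
  conflict-𝟎-≼ : ∀ s → (λ m → F zero 𝟎 m + F zero s m) ≼ (λ m → F i s m + F j 𝟎 m)
  conflict-𝟎-≼ s = submodular f sub (i ∷ s) (j ∷ 𝟎)
    (cong₂ _∷_ (min₀-conflict i≢0 j≢0 i≢j) (zipWith-zeroʳ min₀-zeroʳ s))
    (cong₂ _∷_ (max₀-conflict i≢0 j≢0 i≢j) (zipWith-identityʳ max₀-identityʳ s))

-- The two arguments have disjoint supports: `max₀` glues them together and `min₀` vanishes.
split-≼ : ∀ (f : Vec (Fin (suc k)) (suc n) → ℝ) → k-Submodular f → ∀ i s →
  (λ m → seq (f (zero ∷ 𝟎)) m + seq (f (i ∷ s)) m) ≼
  (λ m → seq (f (i ∷ 𝟎)) m + seq (f (zero ∷ s)) m)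
split-≼ f sub i s = submodular f sub (i ∷ 𝟎) (zero ∷ s)
  (cong₂ _∷_ (min₀-zeroʳ i) (zipWith-zeroˡ min₀-zeroˡ s))
  (cong₂ _∷_ (max₀-identityʳ i) (zipWith-identityˡ max₀-identityˡ s))

-- The bound for three or more labels.

meanᵣ : ∀ k .{{_ : NonZero k}} → (Vec (Fin (suc k)) n → ℝ) → ℕ → ℚ
meanᵣ k f m = mean k (λ s → seq (f s) m)

+-*-factor : ∀ r M → r + r * M ≡ r * (1ℚ + M)
+-*-factor = solve 2 (λ r M → r :+ r :* M := r :* (con 1ℚ :+ M)) refl

pair-identity : ∀ r t a a′ b b′ c d x y →
  ((r * c + t * d) + (r * c + t * d)) + ((x + y) + (r * (a + a′) + t * (b + b′)))
  ≡ (x + y) + (((r * a + t * b) + (r * a′ + t * b′)) + (r * (c + c) + t * (d + d)))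
pair-identity = solve 10 (λ r t a a′ b b′ c d x y →
  ((r :* c :+ t :* d) :+ (r :* c :+ t :* d)) :+ ((x :+ y) :+ (r :* (a :+ a′) :+ t :* (b :+ b′)))
  := (x :+ y) :+ (((r :* a :+ t :* b) :+ (r :* a′ :+ t :* b′)) :+
     (r :* (c :+ c) :+ t :* (d :+ d)))) refl

-- All other terms carry an outer factor `r`, so the target `r * A + r * M * D` is first multiplied
-- by `r + r * M`, which equals one. `A` and `B` are the values at the orthant's first label with
-- tails `o` and `𝟎`, `C` and `D` those at label `zero`.
step-identity : ∀ r M A B C D x y → r + r * M ≡ 1ℚ →
  (r * A + r * M * D) + r * ((x + y) + r * M * (B + C)) ≡
  r * (x + y) + r * (((r * A + r * M * B) + M * (r * C + r * M * D)) + r * M * (D + A))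
step-identity r M A B C D x y eq = trans
  (cong (_+ r * ((x + y) + r * M * (B + C)))
    (trans (sym (ℚ.*-identityˡ (r * A + r * M * D))) (cong (_* (r * A + r * M * D)) (sym eq))))
  (solve 8 (λ r M A B C D x y →
    (r :+ r :* M) :* (r :* A :+ r :* M :* D) :+ r :* ((x :+ y) :+ r :* M :* (B :+ C))
    := r :* (x :+ y) :+ r :* (((r :* A :+ r :* M :* B) :+ M :* (r :* C :+ r :* M :* D))
          :+ r :* M :* (D :+ A))) refl r M A B C D x y)

module MeanBound (j : ℕ) where

  private
    k′ : ℕ
    k′ = 3 ℕ.+ j
    r M : ℚ
    r = + 1 / k′
    -- The number of labels other than a given one.
    M = + (2 ℕ.+ j) / 1

  -- 1 - 1/k′
  t : ℚ
  t = r * M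

  instance
    t-pos : Positive t
    t-pos = ℚ.pos*pos⇒pos r {{ℚ.normalize-pos 1 k′}} M {{ℚ.normalize-pos (2 ℕ.+ j) 1}}

  private
    instance
      r-pos : Positive r
      r-pos = ℚ.normalize-pos 1 k′

    r+t≡1 : r + t ≡ 1ℚ
    r+t≡1 = trans (+-*-factor r M)
      (trans (cong (r *_) (sym (suc/1 (2 ℕ.+ j)))) (1/k*k k′))

    -- Slice `i` keeps its inductive bound, and the other slices together are bounded by `M` copies
    -- of `c`. The values at `suc i ∷ 𝟎` and `zero ∷ o` then both have coefficient `t`, as
    -- `M * r = t`, so `split-≼` is used with weight `t`.
    step : ∀ (f : Vec (Fin (suc k′)) (suc n) → ℝ) → k-Submodular f → ∀ i (o : Vec (Fin (suc k′)) n) →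
      (∀ i′ → (λ m → r * seq (f (suc i′ ∷ o)) m + t * seq (f (suc i′ ∷ 𝟎)) m)
              ≼ meanᵣ k′ (λ s → f (suc i′ ∷ s))) →
      (λ m → r * seq (f (suc i ∷ o)) m + t * seq (f 𝟎) m) ≼ meanᵣ k′ f
    step f sub i o ih = ≼-shift
      (≼-· r (≼-+ (≼-+ (ih i) rest) (≼-· t (split-≼ f sub (suc i) o)))) eq
      where
      F : Fin (suc k′) → Vec (Fin (suc k′)) _ → ℕ → ℚ
      F i s = seq (f (i ∷ s))
      E : Fin k′ → ℕ → ℚ
      E i′ = meanᵣ k′ (λ s → f (suc i′ ∷ s))
      c : ℕ → ℚ
      c m = r * F zero o m + t * F zero 𝟎 m
      pair : ∀ i₁ i₂ → i₁ ≢ i₂ → (λ m → c m + c m) ≼ (λ m → E i₁ m + E i₂ m)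
      -- The two inductive bounds are added, and conflicting labels are replaced by `zero` for both
      -- tails `o` and `𝟎`.
      pair i₁ i₂ i₁≢i₂ = ≼-shift
        (≼-+ (≼-+ (ih i₁) (ih i₂)) (≼-+ (≼-· r (conf o)) (≼-· t (conf 𝟎)))) λ m →
        pair-identity
          r t (F (suc i₁) o m) (F (suc i₂) o m) (F (suc i₁) 𝟎 m) (F (suc i₂) 𝟎 m)
          (F zero o m) (F zero 𝟎 m) (E i₁ m) (E i₂ m)
        where
        conf : ∀ s → (λ m → F zero s m + F zero s m) ≼ (λ m → F (suc i₁) s m + F (suc i₂) s m)
        conf = conflict-≼ f sub (λ ()) (λ ()) (i₁≢i₂ ∘ suc-injective)
      rest : (λ m → sum {2 ℕ.+ j} (λ _ → c m)) ≼ (λ m → sum (λ i′ → E (punchIn i i′) m))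
      -- `punchIn i` enumerates the labels other than `i`, and its injectivity keeps pairs distinct.
      rest = pairwise⇒sum j {λ i′ → E (punchIn i i′)} {c} λ i₁ i₂ i₁≢i₂ →
        pair (punchIn i i₁) (punchIn i i₂) (i₁≢i₂ ∘ punchIn-injective i i₁ i₂)
      eq : ∀ m → (r * F (suc i) o m + t * F zero 𝟎 m) +
                 r * ((E i m + sum (λ i′ → E (punchIn i i′) m)) + t * (F (suc i) 𝟎 m + F zero o m))
               ≡ meanᵣ k′ f m +
                 r * (((r * F (suc i) o m + t * F (suc i) 𝟎 m) + sum {2 ℕ.+ j} (λ _ → c m))
                      + t * (F zero 𝟎 m + F (suc i) o m))
      eq m = trans
        (step-identity r M (F (suc i) o m) (F (suc i) 𝟎 m) (F zero o m) (F zero 𝟎 m)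
          (E i m) (sum (λ i′ → E (punchIn i i′) m)) r+t≡1)
        (cong₂ (λ u v → r * u + r * (((r * F (suc i) o m + t * F (suc i) 𝟎 m) + v)
                                     + t * (F zero 𝟎 m + F (suc i) o m)))
          (sym (sum-remove {i = i} (λ i′ → E i′ m))) (sym (sum-const (2 ℕ.+ j) (c m))))

  mean-≥ : ∀ (f : Vec (Fin (suc k′)) n → ℝ) → k-Submodular f → ∀ {o} → Orthant o →
    (λ m → r * seq (f o) m + t * seq (f 𝟎) m) ≼ meanᵣ k′ f
  -- Here `o` and `𝟎` coincide and the weights add up to one, so equality holds.
  mean-≥ {n = zero} f sub [] = ≼-shift ≼-refl λ m →
    cong (_+ seq (f []) m) (trans (sym (ℚ.*-distribʳ-+ (seq (f []) m) r t))
      (trans (cong (_* seq (f []) m) r+t≡1) (ℚ.*-identityˡ (seq (f []) m))))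
  mean-≥ f sub {zero ∷ o}  (0≢0 ∷ _)  = contradiction refl 0≢0
  mean-≥ f sub {suc i ∷ o} (_ ∷ o≢0) =
    step f sub i o λ i′ → mean-≥ (λ s → f (suc i′ ∷ s)) (slice-submodular f sub (suc i′)) o≢0

-- The bound for two labels.

-- Applied coordinate-wise to `o`, this yields the opposite orthant `o′`.
flip : Fin 3 → Fin 3
flip zero             = zero
flip (suc zero)       = suc (suc zero)
flip (suc (suc zero)) = suc zero

¼ ⅛ : ℚ
¼ = + 1 / 4
⅛ = + 1 / 8

-- In each two-part name the first letter is the first label, with `z` for `zero`, and the rest is
-- the tail. The weight `⅛` is the `¼` of the inductive bounds halved by averaging two slices.
bisubmodular-identity : ∀ ao a0 ao′ bo b0 bo′ zo z0 zo′ x y →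
  ¼ * (ao + (z0 + z0) + bo′) +
    (½ * (x + y) + ⅛ * (((ao′ + b0) + (bo + a0)) + ((a0 + zo) + (b0 + zo′))))
  ≡ ½ * (x + y) +
    (½ * (¼ * (ao + (a0 + a0) + ao′) + ¼ * (bo + (b0 + b0) + bo′)) +
     ⅛ * (((z0 + zo′) + (z0 + zo)) + ((z0 + ao) + (z0 + bo′))))
bisubmodular-identity = solve 11 (λ ao a0 ao′ bo b0 bo′ zo z0 zo′ x y →
  con ¼ :* (ao :+ (z0 :+ z0) :+ bo′) :+
    (con ½ :* (x :+ y) :+ con ⅛ :* (((ao′ :+ b0) :+ (bo :+ a0)) :+ ((a0 :+ zo) :+ (b0 :+ zo′))))
  := con ½ :* (x :+ y) :+
    (con ½ :* (con ¼ :* (ao :+ (a0 :+ a0) :+ ao′) :+ con ¼ :* (bo :+ (b0 :+ b0) :+ bo′)) :+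
     con ⅛ :* (((z0 :+ zo′) :+ (z0 :+ zo)) :+ ((z0 :+ ao) :+ (z0 :+ bo′))))) refl

-- The labels `a` and `b` are left open so that either label can be the first one of the orthant.
bisubmodular-step : ∀ (f : Vec (Fin 3) (suc n) → ℝ) → k-Submodular f →
  ∀ {a b} → a ≢ zero → b ≢ zero → a ≢ b → ∀ (o : Vec (Fin 3) n) {x y : ℕ → ℚ} →
  let F = λ i s → seq (f (i ∷ s)) ; o′ = Vec.map flip o in
  (λ m → ¼ * (F a o m + (F a 𝟎 m + F a 𝟎 m) + F a o′ m)) ≼ x →
  (λ m → ¼ * (F b o m + (F b 𝟎 m + F b 𝟎 m) + F b o′ m)) ≼ y →
  (λ m → ¼ * (F a o m + (F zero 𝟎 m + F zero 𝟎 m) + F b o′ m)) ≼ (λ m → ½ * (x m + y m))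
bisubmodular-step f sub {a} {b} a≢0 b≢0 a≢b o {x} {y} a≼x b≼y = ≼-shift
  (≼-+ (≼-· ½ (≼-+ a≼x b≼y))
       (≼-· ⅛ (≼-+ (≼-+ (conflict-𝟎-≼ f sub a≢0 b≢0 a≢b o′) (conflict-𝟎-≼ f sub b≢0 a≢0 (≢-sym a≢b) o))
                   (≼-+ (split-≼ f sub a o) (split-≼ f sub b o′))))) λ m →
  bisubmodular-identity (F a o m) (F a 𝟎 m) (F a o′ m) (F b o m) (F b 𝟎 m) (F b o′ m)
    (F zero o m) (F zero 𝟎 m) (F zero o′ m) (x m) (y m)
  where
  F  = λ i s → seq (f (i ∷ s))
  o′ = Vec.map flip o

bisubmodular-mean-≥ : ∀ (f : Vec (Fin 3) n → ℝ) → k-Submodular f → ∀ {o} → Orthant o →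
  (λ m → ¼ * (seq (f o) m + (seq (f 𝟎) m + seq (f 𝟎) m) + seq (f (Vec.map flip o)) m)) ≼ meanᵣ 2 f
bisubmodular-mean-≥ f sub [] = ≼-shift ≼-refl λ m →
  cong (_+ seq (f []) m) (base (seq (f []) m))
  where
  base : ∀ x → ¼ * (x + (x + x) + x) ≡ x
  base = solve 1 (λ x → con ¼ :* (x :+ (x :+ x) :+ x) := x) refl
bisubmodular-mean-≥ f sub {i ∷ o} (i≢0 ∷ o≢0) = by-label i i≢0
  where
  ih : ∀ j → _ ≼ _
  ih j = bisubmodular-mean-≥ (λ s → f (j ∷ s)) (slice-submodular f sub j) o≢0
  E : Fin 2 → ℕ → ℚ
  E j = meanᵣ 2 (λ s → f (suc j ∷ s))
  by-label : ∀ i → i ≢ zero →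
    (λ m → ¼ * (seq (f (i ∷ o)) m + (seq (f 𝟎) m + seq (f 𝟎) m) +
                seq (f (flip i ∷ Vec.map flip o)) m)) ≼ meanᵣ 2 f
  by-label zero             0≢0 = contradiction refl 0≢0
  by-label (suc zero)       _ = ≼-trans
    (bisubmodular-step f sub (λ ()) (λ ()) (λ ()) o (ih (suc zero)) (ih (suc (suc zero))))
    -- The sum over `Fin 2` ends in a trailing `0ℚ`.
    (≼-reflexive λ m → cong (λ u → ½ * (E zero m + u)) (sym (ℚ.+-identityʳ (E (suc zero) m))))
  by-label (suc (suc zero)) _ = ≼-trans
    (bisubmodular-step f sub (λ ()) (λ ()) (λ ()) o (ih (suc (suc zero))) (ih (suc zero)))
    -- Here the orthant's own slice comes second in the sum, so the slices are also swapped.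
    (≼-reflexive λ m → cong (½ *_) (trans (ℚ.+-comm (E (suc zero) m) (E zero m))
      (cong (_+_ (E zero m)) (sym (ℚ.+-identityʳ (E (suc zero) m))))))

-- Passing from the strengthened bounds to the expectation.

𝔼-≼ : ∀ k .{{_ : NonZero k}} (f : Vec (Fin (suc k)) n → ℝ) q .{{_ : Positive q}} o (rest : ℕ → ℚ) →
  (λ _ → 0ℚ) ≼ rest → (λ m → q * seq (f o) m + rest m) ≼ meanᵣ k f → q ·ᵣ f o ≤ᵣ 𝔼-orthant f
𝔼-≼ k f q o rest 0≼rest bound = eventually {q·fo} {seq (𝔼-orthant f)} (≼-trans {y = λ m → q·fo m + rest m}
  (≼-shift 0≼rest λ m → sym (ℚ.+-identityʳ (q·fo m + rest m)))
  (≼-trans bound (≼-reflexive λ m → sym (𝔼-mean k f m))))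
  where
  q·fo : ℕ → ℚ
  q·fo m = q * seq (f o) m

theorem10 : ∀ (k n : ℕ) .{{_ : NonZero k}} .{{_ : NonZero n}} → 2 ≤ k →
    (f : Vec (Fin (suc k)) n → ℝ) →
    (∀ s → 0ᵣ ≤ᵣ f s) →
    k-Submodular f →
    (o : Vec (Fin (suc k)) n) → Orthant o →
    (∀ s → f s ≤ᵣ f o) →
    (k ≡ 2 → (+ 1 / 4) ·ᵣ f o ≤ᵣ 𝔼-orthant f) ×
    (3 ≤ k → (+ 1 / k) ·ᵣ f o ≤ᵣ 𝔼-orthant f)
theorem10 k n _ f f≥0 sub o o≢0 _ = case₂ , case₃
  where
  nonNeg : ∀ s → (λ _ → 0ℚ) ≼ seq (f s)
  nonNeg s = mk≼ (f≥0 s)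
  case₂ : k ≡ 2 → (+ 1 / 4) ·ᵣ f o ≤ᵣ 𝔼-orthant f
  case₂ refl = 𝔼-≼ 2 f ¼ o (λ m → ¼ * ((F₀ m + F₀ m) + F′ m))
    (≼-trans (≼-reflexive λ _ → refl) (≼-· ¼ (≼-+ (≼-+ (nonNeg 𝟎) (nonNeg 𝟎)) (nonNeg _))))
    (≼-trans (≼-reflexive λ m → regroup (seq (f o) m) (F₀ m) (F′ m)) (bisubmodular-mean-≥ f sub o≢0))
    where
    F₀ = seq (f 𝟎)
    F′ = seq (f (Vec.map flip o))
    regroup : ∀ x y z → ¼ * x + ¼ * ((y + y) + z) ≡ ¼ * (x + (y + y) + z)
    regroup = solve 3 (λ x y z → con ¼ :* x :+ con ¼ :* ((y :+ y) :+ z)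
                                 := con ¼ :* (x :+ (y :+ y) :+ z)) refl
  case₃ : 3 ≤ k → (+ 1 / k) ·ᵣ f o ≤ᵣ 𝔼-orthant f
  -- Matching on the inequality exposes `k` as `3 + j`, the form used in `MeanBound`.
  case₃ (s≤s (s≤s (s≤s {n = j} _))) = 𝔼-≼ (3 ℕ.+ j) f (+ 1 / (3 ℕ.+ j)) {{ℚ.normalize-pos 1 (3 ℕ.+ j)}} o
    (λ m → t * seq (f 𝟎) m)
    (≼-trans (≼-reflexive λ _ → sym (ℚ.*-zeroʳ t)) (≼-· t (nonNeg 𝟎)))
    (mean-≥ f sub o≢0)
    where open MeanBound j
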